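{- The family of binary delta-matroids is vf-closed, i.e., if $M$ is a binary delta-matroid and $\rho$ is an invertible vertex flip on an element of its ground set, then $M\rho$ is a binary delta-matroid. In particular, every binary delta-matroid is vf-safe.
   Context: A set system is a pair $M=(V,D)$ with $V$ a finite set (the ground set) and $D$ a family of subsets of $V$; it is proper if $D\neq\varnothing$. We write $Y\in M$ for $Y\in D$. $\triangle$ denotes symmetric difference. A delta-matroid is a proper set system $M$ satisfying the symmetric exchange axiom: for all $X,Y\in M$ and all $u\in X\triangle Y$, either $X\triangle\{u\}\in M$ or there is a $w\in X\triangle Y$ with $w\neq u$ such that $X\triangle\{u,w\}\in M$. For $X\subseteq V$, the pivot of $M$ on $X$ is $M*X=(V,\{Y\triangle X\mid Y\in D\})$; for $v\in V$, $M*v=M*\{v\}$, and the loop complementation of $M$ on $v$ is $M+v=(V,D\triangle\{Z\cup\{v\}\mid Z\in D,\ v\notin Z\})$. The operations $*v$ and $+v$ are involutions generating a group of order $6$ (isomorphic to $S_3$) of operations on set systems over $V$; these six operations (including the identity) are the invertible vertex flips on $v$. Operations are applied from left to right. For a $V\times V$ matrix $A$ over a field, $\mathcal{M}_A=(V,\{X\subseteq V\mid A[X]\text{ is nonsingular}\})$, where $A[X]$ is the principal submatrix of $A$ on $X$ and the empty matrix is nonsingular by convention. A delta-matroid $M$ is representable over a field $\mathbb{F}$ if $M=\mathcal{M}_A*X$ for some skew-symmetric $V\times V$ matrix $A$ over $\mathbb{F}$ (i.e., $A^T=-A$; nonzero diagonal entries are allowed in characteristic $2$) and some $X\subseteq V$.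 A delta-matroid is binary if it is representable over $\mathbb{F}_2$ (so $A$ is any symmetric matrix over $\mathbb{F}_2$). A family of delta-matroids is vf-closed if it is closed under invertible vertex flips. A delta-matroid $M$ is vf-safe (vertex-flip-safe) if for any sequence $\varphi$ of invertible vertex flips (equivalently, of pivots and loop complementations) on elements of $V$, $M\varphi$ is a delta-matroid. -}

module Defs where

open import Level using (0ℓ)
open import Algebra.Apartness using (HeytingCommutativeRing; HeytingField)
open import Algebra.Bundles using (CommutativeRing)
import Algebra.Definitions as AlgDefs
open import Data.Bool.Base using (Bool; true; false; _xor_; _∧_; if_then_else_)
open import Data.Bool.Properties using (xor-∧-commutativeRing)
open import Data.Fin.Base using (Fin; zero; suc)
open import Data.Fin.Properties using (_≟_)
open import Data.Fin.Subset using (Subset; inside; outside; ⁅_⁆; ∣_∣)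
import Data.Fin.Subset as FS
open import Data.List.Base using (List; foldl)
open import Data.Nat.Base using (ℕ)
open import Data.Product.Base using (∃; _×_; _,_)
open import Data.Sum.Base using (_⊎_; inj₁; inj₂)
open import Data.Vec.Base using ([]; _∷_; zipWith)
open import Data.Vec.Functional using (Vector)
open import Function.Base using (_∘_)
open import Relation.Binary.PropositionalEquality using (_≡_; _≢_; refl; sym)
open import Relation.Binary.Definitions using (Tight)
open import Relation.Nullary using (does; contradiction)
open import Relation.Unary using (Pred; _∈_; Satisfiable; _∪_; _∖_; _≐_)

private
  variable
    n : ℕ

infixl 6 _△_
_△_ : Subset n → Subset n → Subset n
_△_ = zipWith _xor_

-- The ground set is Fin n; two set systems are considered equal when they
-- have the same members (_≐_). Membership is not assumed to be decidable.
SetSystem : ℕ → Set₁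
SetSystem n = Pred (Subset n) 0ℓ

SymmetricExchange : SetSystem n → Set
SymmetricExchange M =
  ∀ {X Y} → X ∈ M → Y ∈ M → ∀ {u} → u FS.∈ X △ Y →
    (X △ ⁅ u ⁆ ∈ M)
    ⊎ (∃ λ w → w FS.∈ X △ Y × w ≢ u × X △ (⁅ u ⁆ FS.∪ ⁅ w ⁆) ∈ M)

IsDeltaMatroid : SetSystem n → Set
IsDeltaMatroid M = Satisfiable M × SymmetricExchange M

infixl 7 _✶_ _✶ᵛ_ _+ᵛ_

_✶_ : SetSystem n → Subset n → SetSystem n
(M ✶ X) Z = ∃ λ Y → Y ∈ M × Z ≡ Y △ X

_✶ᵛ_ : SetSystem n → Fin n → SetSystem n
M ✶ᵛ v = M ✶ ⁅ v ⁆

_+ᵛ_ : SetSystem n → Fin n → SetSystem n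
M +ᵛ v = (M ∖ N) ∪ (N ∖ M)
  where
  N : SetSystem _
  N Y = ∃ λ Z → Z ∈ M × v FS.∉ Z × Y ≡ Z FS.∪ ⁅ v ⁆

data Generator : Set where
  pivot loopc : Generator

-- The group of invertible vertex flips on an element is generated by its
-- pivot and its loop complementation. Both are involutions, so words in the
-- generators represent all six flips (each one by several words).
VertexFlip : Set
VertexFlip = List Generator

applyGenerator : Fin n → SetSystem n → Generator → SetSystem n
applyGenerator v M pivot = M ✶ᵛ v
applyGenerator v M loopc = M +ᵛ v

flip : SetSystem n → Fin n × VertexFlip → SetSystem n
flip M (v , ρ) = foldl (applyGenerator v) M ρ

VfClosed : (∀ {n} → SetSystem n → Set) → Set₁
VfClosed 𝓕 = ∀ {n} (M : SetSystem n) → 𝓕 M →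
  (v : Fin n) (ρ : VertexFlip) → 𝓕 (flip M (v , ρ))

VfSafe : SetSystem n → Set
VfSafe {n} M = (φ : List (Fin n × VertexFlip)) → IsDeltaMatroid (foldl flip M φ)

-- The increasing enumeration of the elements of a subset.
elements : (X : Subset n) → Fin ∣ X ∣ → Fin n
elements (inside  ∷ X) zero    = zero
elements (inside  ∷ X) (suc i) = suc (elements X i)
elements (outside ∷ X) i       = suc (elements X i)

module Representation (𝔽 : HeytingField 0ℓ 0ℓ 0ℓ) where
  open HeytingField 𝔽 using (Carrier; _≈_; _*_; -_; 0#; 1#; heytingCommutativeRing)
  open HeytingCommutativeRing heytingCommutativeRing using (commutativeRing)
  open CommutativeRing commutativeRing using (+-monoid)
  open import Algebra.Properties.Monoid.Sum +-monoid using (sum)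

  Matrix : ℕ → Set
  Matrix m = Vector (Vector Carrier m) m

  _≈ᴹ_ : ∀ {m} → Matrix m → Matrix m → Set
  A ≈ᴹ B = ∀ i j → A i j ≈ B i j

  _*ᴹ_ : ∀ {m} → Matrix m → Matrix m → Matrix m
  (A *ᴹ B) i k = sum λ j → A i j * B j k

  1ᴹ : ∀ {m} → Matrix m
  1ᴹ i j = if does (i ≟ j) then 1# else 0#

  Nonsingular : ∀ {m} → Matrix m → Set
  Nonsingular = AlgDefs.Invertible _≈ᴹ_ 1ᴹ _*ᴹ_

  SkewSymmetric : ∀ {m} → Matrix m → Set
  SkewSymmetric A = ∀ i j → A j i ≈ - (A i j)

  _[_] : Matrix n → (X : Subset n) → Matrix ∣ X ∣
  (A [ X ]) i j = A (elements X i) (elements X j)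

  𝓜 : Matrix n → SetSystem n
  𝓜 A X = Nonsingular (A [ X ])

  Representable : SetSystem n → Set
  Representable {n} M =
    IsDeltaMatroid M × ∃ λ (A : Matrix n) → SkewSymmetric A × ∃ λ X → M ≐ 𝓜 A ✶ X

𝔽₂ : HeytingField 0ℓ 0ℓ 0ℓ
𝔽₂ = record
  { Carrier = Bool
  ; _≈_ = _≡_
  ; _#_ = _≢_
  ; _+_ = _xor_
  ; _*_ = _∧_
  ; -_ = CommutativeRing.-_ xor-∧-commutativeRing
  ; 0# = false
  ; 1# = true
  ; isHeytingField = record
    { isHeytingCommutativeRing = record
      { isCommutativeRing = CommutativeRing.isCommutativeRing xor-∧-commutativeRing
      ; isApartnessRelation = record
        { irrefl  = λ x≡y x≢y → x≢y x≡y
        ; sym     = λ x≢y → x≢y ∘ sym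
        ; cotrans = cotrans _ _
        }
      ; #⇒invertible = #⇒inv _ _
      ; invertible⇒# = inv⇒# _ _
      }
    ; tight = tight
    }
  }
  where
  open AlgDefs {A = Bool} _≡_ using (Invertible)

  cotrans : ∀ x y → x ≢ y → ∀ z → x ≢ z ⊎ z ≢ y
  cotrans false false x≢y _     = contradiction refl x≢y
  cotrans true  true  x≢y _     = contradiction refl x≢y
  cotrans false true  _   false = inj₂ λ ()
  cotrans false true  _   true  = inj₁ λ ()
  cotrans true  false _   false = inj₁ λ ()
  cotrans true  false _   true  = inj₂ λ ()

  #⇒inv : ∀ x y → x ≢ y → Invertible true _∧_ (x xor y)
  #⇒inv false false x≢y = contradiction refl x≢y
  #⇒inv true  true  x≢y = contradiction refl x≢y
  #⇒inv false true  _   = true , refl , refl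
  #⇒inv true  false _   = true , refl , refl

  inv⇒# : ∀ x y → Invertible true _∧_ (x xor y) → x ≢ y
  inv⇒# false true  _ ()
  inv⇒# true  false _ ()
  inv⇒# false false (_ , _ , ())
  inv⇒# true  true  (_ , _ , ())

  tight : Tight _≡_ _≢_
  tight false false = (λ _ → refl) , λ p q → q p
  tight true  true  = (λ _ → refl) , λ p q → q p
  tight false true  = (λ h → contradiction (λ ()) h) , λ p q → q p
  tight true  false = (λ h → contradiction (λ ()) h) , λ p q → q p

IsBinaryDeltaMatroid : SetSystem n → Set
IsBinaryDeltaMatroid = Representation.Representable 𝔽₂

-- Represent a set system by a totally isotropic subspace L of the symplectic space
-- (F₂²)ⁿ: X is feasible when L meets trivially the space of vectors whose coordinate
-- at v lies on the line q = 0 for v ∈ X and on p = 0 for v ∉ X. For 𝓜 A, L is the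
-- graph of A, and conversely, if ∅ is feasible for an n-dimensional L then L is the
-- graph of a symmetric matrix. Pivoting at v swaps the lines p = 0 and q = 0 of F₂².
-- Of the three lines at v (the third is p = q), L is complementary to none or to exactly
-- two, whatever is prescribed elsewhere; hence loop complementation swaps q = 0 and
-- p = q. So flips just change coordinates at v, and symmetric exchange follows from
-- isotropy alone.
module Submission where

open import Defs
open import Algebra.Bundles using (CommutativeRing)
open import Data.Bool.Base using (Bool; true; false; not; _xor_; _∧_; _∨_; if_then_else_)
open import Data.Bool.Properties
  using (xor-∧-commutativeRing; xor-same; xor-identityˡ; xor-identityʳ; xor-assoc; xor-comm;
         xor-inverseʳ; ∧-assoc; ∧-comm; ∧-distribˡ-xor; ∧-zeroʳ; ∧-identityʳ; ∨-zeroʳ; ∨-identityʳ; ¬-not)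
  renaming (_≟_ to _≟ᵇ_)
open import Data.Bool.Solver using (module xor-∧-Solver)
open import Data.Fin.Base using (Fin; zero; suc; punchIn; punchOut)
open import Data.Fin.Properties using (_≟_; all?; ¬∀⟶∃¬; punchInᵢ≢i; punchIn-punchOut)
open import Data.Fin.Subset using (Subset; ⁅_⁆; ∣_∣; ⊥)
import Data.Fin.Subset as FS
open import Data.Fin.Subset.Properties using (anySubset?)
open import Data.List.Base using ([]; _∷_)
open import Data.Nat.Base using (ℕ; zero; suc)
open import Data.Product using (∃; _×_; _,_; proj₁; proj₂)
open import Data.Sum.Base using (_⊎_; inj₁; inj₂; [_,_]′; map₁)
open import Data.Vec.Base using ([]; _∷_; head; tail; lookup; tabulate)
open import Data.Vec.Properties
  using (zipWith-identityˡ; zipWith-inverseˡ; lookup-zipWith; lookup-replicate;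
         lookup∘tabulate; tabulate∘lookup; tabulate-cong; map-id; ≡-dec; []=⇒lookup; lookup⇒[]=)
open import Function.Base using (_∘_; _$_; case_of_)
open import Relation.Binary.PropositionalEquality hiding ([_])
open import Relation.Nullary using (¬_; yes; no; does; contradiction; ¬?; _×-dec_; _→-dec_)
open import Relation.Nullary.Decidable using (dec-true; dec-false; decidable-stable)
open import Relation.Unary using (_∈_; _≐_; Decidable; Satisfiable)

open import Algebra.Properties.Semiring.Sum
  (CommutativeRing.semiring xor-∧-commutativeRing)

private
  variable
    k m n : ℕ

-- Linear functionals over F₂

Functional : ℕ → Set
Functional n = Subset n → Bool

Linear : Functional n → Set
Linear f = ∀ x y → f (x △ y) ≡ f x xor f y

lookup-injective : {x y : Subset n} → (∀ i → lookup x i ≡ lookup y i) → x ≡ y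
lookup-injective {x = x} {y} eq =
  trans (sym (tabulate∘lookup x)) (trans (tabulate-cong eq) (tabulate∘lookup y))

△-identityˡ : (x : Subset n) → ⊥ △ x ≡ x
△-identityˡ = zipWith-identityˡ xor-identityˡ

△-self : (x : Subset n) → x △ x ≡ ⊥
△-self x = trans (cong (_△ x) (sym (map-id x))) (zipWith-inverseˡ xor-same x)

lookup-△ : ∀ (x y : Subset n) i → lookup (x △ y) i ≡ lookup x i xor lookup y i
lookup-△ x y i = lookup-zipWith _xor_ i x y

xor≡false⇒≡ : ∀ a b → a xor b ≡ false → a ≡ b
xor≡false⇒≡ false false _ = refl
xor≡false⇒≡ true  true  _ = refl

△≡⊥⇒≡ : (x y : Subset n) → x △ y ≡ ⊥ → x ≡ y
△≡⊥⇒≡ x y eq = lookup-injective λ i →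
  xor≡false⇒≡ _ _ (trans (sym (lookup-△ x y i)) (trans (cong (λ z → lookup z i) eq) (lookup-replicate i false)))

linear-⊥ : (f : Functional n) → Linear f → f ⊥ ≡ false
linear-⊥ f lin = trans (cong f (sym (△-self ⊥))) (trans (lin ⊥ ⊥) (xor-same (f ⊥)))

Kernel : (Fin m → Functional n) → Subset n → Set
Kernel F x = ∀ i → F i x ≡ false

TrivialKernel : (Fin m → Functional n) → Set
TrivialKernel F = ∀ x → Kernel F x → x ≡ ⊥

-- Parametrises solutions of the single equation `r x = 0` by one coordinate fewer. An injection
-- into the kernel suffices for eliminating equations one at a time.
record HyperplaneMap (r : Functional (suc k)) : Set where
  field
    map       : Subset k → Subset (suc k)
    additive  : ∀ x y → map (x △ y) ≡ map x △ map y
    injective : ∀ x → map x ≡ ⊥ → x ≡ ⊥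
    kernel    : ∀ x → r (map x) ≡ false

hyperplaneMap : {r : Functional (suc k)} → Linear r → HyperplaneMap r
hyperplaneMap {k} {r} lin with r (true ∷ ⊥) in eq
-- The first unit vector is not a solution, so the first coordinate is solved for in terms of the
-- others. In the remaining cases it is free and the elimination recurses on the tail.
... | true = record
  { map       = λ x → r (false ∷ x) ∷ x
  ; additive  = λ x y → cong (_∷ x △ y) (lin (false ∷ x) (false ∷ y))
  ; injective = λ x → cong tail
  ; kernel    = λ x → kernel x (r (false ∷ x)) refl
  }
  where
  kernel : ∀ x b → r (false ∷ x) ≡ b → r (b ∷ x) ≡ false
  kernel x false e = e
  kernel x true  e = begin
    r (true ∷ x)                     ≡⟨ cong (λ y → r (true ∷ y)) (△-identityˡ x) ⟨
    r ((true ∷ ⊥) △ (false ∷ x))     ≡⟨ lin (true ∷ ⊥) (false ∷ x) ⟩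
    r (true ∷ ⊥) xor r (false ∷ x)   ≡⟨ cong₂ _xor_ eq e ⟩
    false                            ∎
    where open ≡-Reasoning
hyperplaneMap {zero} {r} lin | false = record
  { map       = λ _ → ⊥
  ; additive  = λ _ _ → refl
  ; injective = λ where [] _ → refl
  ; kernel    = λ _ → linear-⊥ r lin
  }
hyperplaneMap {suc k} {r} lin | false = record
  { map       = λ x → head x ∷ map (tail x)
  ; additive  = λ where (a ∷ x) (b ∷ y) → cong ((a xor b) ∷_) (additive x y)
  ; injective = λ where (a ∷ x) e → cong₂ _∷_ (cong head e) (injective x (cong tail e))
  ; kernel    = λ where
      (false ∷ x) → kernel x
      (true  ∷ x) → begin
        r (true ∷ map x)                    ≡⟨ cong (λ y → r (true ∷ y)) (△-identityˡ (map x)) ⟨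
        r ((true ∷ ⊥) △ (false ∷ map x))    ≡⟨ lin (true ∷ ⊥) (false ∷ map x) ⟩
        r (true ∷ ⊥) xor r (false ∷ map x)  ≡⟨ cong₂ _xor_ eq (kernel x) ⟩
        false                               ∎
  }
  where
  open HyperplaneMap (hyperplaneMap {r = λ x → r (false ∷ x)} λ x y → lin (false ∷ x) (false ∷ y))
  open ≡-Reasoning

-- Gaussian elimination: pulling the other functionals back along a hyperplane map of the first
-- removes one equation and one unknown. At the end one unknown is left with no equation.
wide⇒nontrivialKernel : (F : Fin m → Functional (suc m)) → (∀ i → Linear (F i)) →
  ∃ λ x → x ≢ ⊥ × Kernel F x
wide⇒nontrivialKernel {zero}  F lin = true ∷ [] , (λ ()) , λ ()
wide⇒nontrivialKernel {suc m} F lin =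
  let x , x≢⊥ , Fx = wide⇒nontrivialKernel (λ i x → F (suc i) (map x))
        λ i x y → trans (cong (F (suc i)) (additive x y)) (lin (suc i) _ _)
  in map x , x≢⊥ ∘ injective x , λ where
      zero    → kernel x
      (suc i) → Fx i
  where open HyperplaneMap (hyperplaneMap {r = F zero} (lin zero))

kernelWithout : (v : Fin n) (F : Fin n → Functional n) → (∀ i → Linear (F i)) →
  ∃ λ x → x ≢ ⊥ × ∀ i → i ≢ v → F i x ≡ false
kernelWithout {suc n} v F lin =
  let x , x≢⊥ , Fx = wide⇒nontrivialKernel (F ∘ punchIn v) (lin ∘ punchIn v)
  in x , x≢⊥ , λ i i≢v →
    subst (λ j → F j x ≡ false) (punchIn-punchOut (i≢v ∘ sym)) (Fx (punchOut (i≢v ∘ sym)))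

-- Homogenise: the system `b y + F x = 0` has one more unknown than equations, hence a nonzero
-- solution, and the trivial kernel rules out `b = 0`.
trivialKernel⇒surjective : (F : Fin n → Functional n) → (∀ i → Linear (F i)) →
  TrivialKernel F → (y : Fin n → Bool) → ∃ λ x → ∀ i → F i x ≡ y i
trivialKernel⇒surjective {n} F lin trivial y = solution (wide⇒nontrivialKernel G G-linear)
  where
  G : Fin n → Functional (suc n)
  G i (b ∷ x) = (b ∧ y i) xor F i x

  G-linear : ∀ i → Linear (G i)
  G-linear i (a ∷ u) (b ∷ v) = trans (cong (((a xor b) ∧ y i) xor_) (lin i u v))
    (solve 5 (λ a b c d e → (a :+ b) :* c :+ (d :+ e) := (a :* c :+ d) :+ (b :* c :+ e)) refl
       a b (y i) (F i u) (F i v))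
    where open xor-∧-Solver

  solution : (∃ λ x → x ≢ ⊥ × Kernel G x) → ∃ λ x → ∀ i → F i x ≡ y i
  solution (false ∷ x , x≢⊥ , Gx) = contradiction (cong (false ∷_) (trivial x Gx)) x≢⊥
  solution (true ∷ x , _ , Gx) = x , λ i → sym (xor≡false⇒≡ (y i) _ (Gx i))

trivial⊎nonzero : {P : Subset n → Set} → Decidable P →
  (∀ x → P x → x ≡ ⊥) ⊎ ∃ λ x → x ≢ ⊥ × P x
trivial⊎nonzero P? with anySubset? (λ x → ¬? (≡-dec _≟ᵇ_ x ⊥) ×-dec P? x)
... | yes nonzero  = inj₂ nonzero
... | no  ¬nonzero = inj₁ λ x Px →
  decidable-stable (≡-dec _≟ᵇ_ x ⊥) λ x≢⊥ → ¬nonzero (x , x≢⊥ , Px)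

kernel? : (F : Fin m → Functional n) → Decidable (Kernel F)
kernel? F x = all? λ i → F i x ≟ᵇ false

sum-isolate : (t : Fin n → Bool) (v : Fin n) → (∀ i → i ≢ v → t i ≡ false) → sum t ≡ t v
sum-isolate {suc n} t v off = begin
  sum t                          ≡⟨ sum-remove {i = v} t ⟩
  t v xor sum (t ∘ punchIn v)    ≡⟨ cong (t v xor_) (sum-cong-≗ λ i → off (punchIn v i) (punchInᵢ≢i v i)) ⟩
  t v xor sum {n} (λ _ → false)  ≡⟨ cong (t v xor_) (sum-replicate-zero n) ⟩
  t v xor false                  ≡⟨ xor-identityʳ (t v) ⟩
  t v                            ∎
  where open ≡-Reasoning

-- Membership after toggling elements

lookup-⁅⁆ : ∀ (v i : Fin n) → lookup ⁅ v ⁆ i ≡ does (i ≟ v)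
lookup-⁅⁆ zero    zero    = refl
lookup-⁅⁆ zero    (suc i) = lookup-replicate i false
lookup-⁅⁆ (suc v) zero    = refl
lookup-⁅⁆ (suc v) (suc i) = lookup-⁅⁆ v i

lookup-△⁅⁆ : ∀ (X : Subset n) v i → lookup (X △ ⁅ v ⁆) i ≡ lookup X i xor does (i ≟ v)
lookup-△⁅⁆ X v i = trans (lookup-△ X ⁅ v ⁆ i) (cong (lookup X i xor_) (lookup-⁅⁆ v i))

lookup-△⁅⁆-≢ : ∀ (X : Subset n) {v i} → i ≢ v → lookup (X △ ⁅ v ⁆) i ≡ lookup X i
lookup-△⁅⁆-≢ X {v} {i} i≢v = begin
  lookup (X △ ⁅ v ⁆) i          ≡⟨ lookup-△⁅⁆ X v i ⟩
  lookup X i xor does (i ≟ v)   ≡⟨ cong (lookup X i xor_) (dec-false (i ≟ v) i≢v) ⟩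
  lookup X i xor false          ≡⟨ xor-identityʳ _ ⟩
  lookup X i                    ∎
  where open ≡-Reasoning

lookup-△⁅⁆-≡ : ∀ (X : Subset n) v → lookup (X △ ⁅ v ⁆) v ≡ not (lookup X v)
lookup-△⁅⁆-≡ X v = begin
  lookup (X △ ⁅ v ⁆) v          ≡⟨ lookup-△⁅⁆ X v v ⟩
  lookup X v xor does (v ≟ v)   ≡⟨ cong (lookup X v xor_) (dec-true (v ≟ v) refl) ⟩
  lookup X v xor true           ≡⟨ xor-comm (lookup X v) true ⟩
  not (lookup X v)              ∎
  where open ≡-Reasoning

-- The exchange axiom toggles a union at once, the argument toggles one element at a time; these
-- agree because the two elements differ.
△-pair : ∀ (X : Subset n) {u w} → w ≢ u → X △ (⁅ u ⁆ FS.∪ ⁅ w ⁆) ≡ X △ ⁅ u ⁆ △ ⁅ w ⁆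
△-pair X {u} {w} w≢u = lookup-injective λ i → begin
  lookup (X △ (⁅ u ⁆ FS.∪ ⁅ w ⁆)) i                 ≡⟨ lookup-△ X _ i ⟩
  lookup X i xor lookup (⁅ u ⁆ FS.∪ ⁅ w ⁆) i        ≡⟨ cong (lookup X i xor_) (pair i) ⟩
  lookup X i xor (does (i ≟ u) xor does (i ≟ w))    ≡⟨ xor-assoc (lookup X i) _ _ ⟨
  (lookup X i xor does (i ≟ u)) xor does (i ≟ w)    ≡⟨ cong (_xor does (i ≟ w)) (lookup-△⁅⁆ X u i) ⟨
  lookup (X △ ⁅ u ⁆) i xor does (i ≟ w)             ≡⟨ lookup-△⁅⁆ (X △ ⁅ u ⁆) w i ⟨
  lookup (X △ ⁅ u ⁆ △ ⁅ w ⁆) i                      ∎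
  where
  open ≡-Reasoning
  pair : ∀ i → lookup (⁅ u ⁆ FS.∪ ⁅ w ⁆) i ≡ does (i ≟ u) xor does (i ≟ w)
  pair i rewrite lookup-zipWith _∨_ i ⁅ u ⁆ ⁅ w ⁆ | lookup-⁅⁆ u i | lookup-⁅⁆ w i with i ≟ u | i ≟ w
  ... | yes refl | yes refl = contradiction refl w≢u
  ... | yes _    | no  _    = refl
  ... | no  _    | _        = refl

-- Isotropic systems

-- The x ∈ F₂ⁿ parametrise a totally isotropic subspace of the symplectic space
-- (F₂²)ⁿ; p i x and q i x are the two coordinates of x at i.
record IsotropicSystem (n : ℕ) : Set where
  field
    p q : Fin n → Functional n
    p-linear : ∀ i → Linear (p i)
    q-linear : ∀ i → Linear (q i)

  -- The standard symplectic form, that is the determinant, on the plane F₂² at `i`.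
  form : Fin n → Subset n → Subset n → Bool
  form i x y = (p i x ∧ q i y) xor (q i x ∧ p i y)

  field
    isotropic : ∀ x y → sum (λ i → form i x y) ≡ false

  coord : Bool → Fin n → Functional n
  coord b i = if b then q i else p i

  transversal : Subset n → Fin n → Functional n
  transversal X i = coord (lookup X i) i

  -- A vector with all coordinates zero lies in every such kernel, so one feasible set already makes
  -- the parametrisation injective and the subspace Lagrangian.
  Feasible : SetSystem n
  Feasible X = TrivialKernel (transversal X)

  coord-linear : ∀ b i → Linear (coord b i)
  coord-linear false = p-linear
  coord-linear true  = q-linear

  form-coord : ∀ b i x y → form i x y ≡
    (coord b i x ∧ coord (not b) i y) xor (coord (not b) i x ∧ coord b i y)
  form-coord false i x y = refl
  form-coord true  i x y = xor-comm (p i x ∧ q i y) _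

  form-local : ∀ v x y → (∀ i → i ≢ v → form i x y ≡ false) → form v x y ≡ false
  form-local v x y off = trans (sym (sum-isolate (λ i → form i x y) v off)) (isotropic x y)

  form-vanishes : ∀ b i {x y} → coord b i x ≡ false → coord b i y ≡ false → form i x y ≡ false
  form-vanishes b i {x} {y} cx cy rewrite form-coord b i x y | cx | cy = ∧-zeroʳ _

  OffKernel : Subset n → Fin n → Subset n → Set
  OffKernel X v x = ∀ i → i ≢ v → transversal X i x ≡ false

  -- Away from `v` both vectors lie on the same line of each plane, where the form vanishes;
  -- isotropy then kills the one remaining term.
  offKernel-form : ∀ X v {x y} → OffKernel X v x → OffKernel X v y → form v x y ≡ false
  offKernel-form X v {x} {y} Kx Ky = form-local v x y λ i i≢v →
    form-vanishes (lookup X i) i (Kx i i≢v) (Ky i i≢v)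

  kernel-split : ∀ X v {x} → OffKernel X v x → coord (lookup X v) v x ≡ false →
    Kernel (transversal X) x
  kernel-split X v Kx vx i with i ≟ v
  ... | yes refl = vx
  ... | no i≢v   = Kx i i≢v

  offKernel-△⁅⁆ : ∀ X v {x} → OffKernel (X △ ⁅ v ⁆) v x → OffKernel X v x
  offKernel-△⁅⁆ X v {x} Kx i i≢v =
    subst (λ b → coord b i x ≡ false) (lookup-△⁅⁆-≢ X i≢v) (Kx i i≢v)

  offKernel-△⁅⁆⁻ : ∀ X v {x} → OffKernel X v x → OffKernel (X △ ⁅ v ⁆) v x
  offKernel-△⁅⁆⁻ X v {x} Kx i i≢v =
    subst (λ b → coord b i x ≡ false) (sym (lookup-△⁅⁆-≢ X i≢v)) (Kx i i≢v)

  -- Over a feasible X the subspace cut out by the conditions off u is at most a line.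
  offKernel-line : ∀ X u {x y} → Feasible X → OffKernel X u x → OffKernel X u y →
    x ≢ ⊥ → y ≢ ⊥ → x ≡ y
  offKernel-line X u {x} {y} fX Kx Ky x≢⊥ y≢⊥ = △≡⊥⇒≡ x y $ fX (x △ y) $ kernel-split X u
    (λ i i≢u → trans (coord-linear _ i x y) (cong₂ _xor_ (Kx i i≢u) (Ky i i≢u)))
    (trans (coord-linear _ u x y) (cong₂ _xor_ (nonzero Kx x≢⊥) (nonzero Ky y≢⊥)))
    where
    nonzero : ∀ {z} → OffKernel X u z → z ≢ ⊥ → coord (lookup X u) u z ≡ true
    nonzero Kz z≢⊥ = ¬-not λ uz → z≢⊥ (fX _ (kernel-split X u Kz uz))

  -- If `X △ ⁅ u ⁆` is infeasible, it has a nonzero kernel vector `e`. Feasibility of `Y` gives a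
  -- `w` where `e` leaves the line of `Y`, and toggling this `w` repairs feasibility: isotropy puts
  -- a new kernel vector into the span of `e`, but the condition at `w` excludes `e`.
  symmetricExchange : SymmetricExchange Feasible
  symmetricExchange {X} {Y} fX fY {u} u∈ with trivial⊎nonzero (kernel? (transversal (X △ ⁅ u ⁆)))
  ... | inj₁ feasible = inj₁ feasible
  ... | inj₂ (e , e≢⊥ , Ke) = inj₂ (w , w∈ , w≢u , subst Feasible (sym (△-pair X w≢u)) feasible)
    where
    X′ = X △ ⁅ u ⁆

    Ye≢0 : ∃ λ w → transversal Y w e ≢ false
    Ye≢0 = ¬∀⟶∃¬ n _ (λ w → transversal Y w e ≟ᵇ false) (e≢⊥ ∘ fY e)

    w = proj₁ Ye≢0

    Y≢X′ : lookup Y w ≢ lookup X′ w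
    Y≢X′ eq = proj₂ Ye≢0 (subst (λ b → coord b w e ≡ false) (sym eq) (Ke w))

    Y≡¬X′ : lookup Y w ≡ not (lookup X′ w)
    Y≡¬X′ = ¬-not Y≢X′

    ew : coord (not (lookup X′ w)) w e ≡ true
    ew = subst (λ b → coord b w e ≡ true) Y≡¬X′ (¬-not (proj₂ Ye≢0))

    xor≡true⇒≡not : ∀ a b → a xor b ≡ true → b ≡ not a
    xor≡true⇒≡not false true  _ = refl
    xor≡true⇒≡not true  false _ = refl

    -- Since `u` lies in `X △ Y`, the sets `X′` and `Y` agree at `u`, whereas they differ at `w`.
    w≢u : w ≢ u
    w≢u w≡u = Y≢X′ (subst (λ i → lookup Y i ≡ lookup X′ i) (sym w≡u) (trans
      (xor≡true⇒≡not (lookup X u) _ (trans (sym (lookup-△ X Y u)) ([]=⇒lookup u∈)))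
      (sym (lookup-△⁅⁆-≡ X u))))

    w∈ : w FS.∈ X △ Y
    w∈ = lookup⇒[]= w (X △ Y) $ begin
      lookup (X △ Y) w                   ≡⟨ lookup-△ X Y w ⟩
      lookup X w xor lookup Y w          ≡⟨ cong (_xor lookup Y w) (lookup-△⁅⁆-≢ X w≢u) ⟨
      lookup X′ w xor lookup Y w         ≡⟨ cong (lookup X′ w xor_) Y≡¬X′ ⟩
      lookup X′ w xor not (lookup X′ w)  ≡⟨ xor-inverseʳ (lookup X′ w) ⟩
      true                               ∎
      where open ≡-Reasoning

    feasible : Feasible (X′ △ ⁅ w ⁆)
    feasible g Kg = decidable-stable (≡-dec _≟ᵇ_ g ⊥) λ g≢⊥ →
      contradiction
        (trans (sym gw) (subst (λ z → coord (not (lookup X′ w)) w z ≡ true) (sym (g≡e g≢⊥)) ew))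
        λ ()
      where
      gw : coord (not (lookup X′ w)) w g ≡ false
      gw = subst (λ b → coord b w g ≡ false) (lookup-△⁅⁆-≡ X′ w) (Kg w)

      g-off : OffKernel X′ w g
      g-off = offKernel-△⁅⁆ X′ w λ i _ → Kg i

      -- In the form of `g` and `e` at `w`, `e` has coordinate 1 and `g` has coordinate 0 on the
      -- side opposite to `X′`, so the form equals the value to be shown zero.
      X′wg : transversal X′ w g ≡ false
      X′wg = begin
        coord b w g                                              ≡⟨ ∧-identityʳ _ ⟨
        coord b w g ∧ true                                       ≡⟨ cong (coord b w g ∧_) ew ⟨
        coord b w g ∧ coord (not b) w e                          ≡⟨ xor-identityʳ _ ⟨
        (coord b w g ∧ coord (not b) w e) xor (false ∧ coord b w e)
          ≡⟨ cong (λ c → (coord b w g ∧ coord (not b) w e) xor (c ∧ coord b w e)) gw ⟨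
        (coord b w g ∧ coord (not b) w e) xor (coord (not b) w g ∧ coord b w e)
          ≡⟨ form-coord b w g e ⟨
        form w g e                                               ≡⟨ offKernel-form X′ w g-off (λ i _ → Ke i) ⟩
        false                                                    ∎
        where
        open ≡-Reasoning
        b = lookup X′ w

      g≡e : g ≢ ⊥ → g ≡ e
      g≡e g≢⊥ = offKernel-line X u fX
        (offKernel-△⁅⁆ X u λ i _ → kernel-split X′ w g-off X′wg i)
        (offKernel-△⁅⁆ X u λ i _ → Ke i) g≢⊥ e≢⊥

  -- With the conditions of `X` imposed away from `v`, the line `f = 0` at `v` is complementary to
  -- the subspace. Here `f` can also be p + q, which no subset selects.
  TrivialAt : Subset n → Fin n → Functional n → Set
  TrivialAt X v f = ∀ x → OffKernel X v x → f x ≡ false → x ≡ ⊥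

  feasible⇒trivialAt : ∀ X v → Feasible X → TrivialAt X v (coord (lookup X v) v)
  feasible⇒trivialAt X v fX x Kx vx = fX x (kernel-split X v Kx vx)

  trivialAt⇒feasible : ∀ X v → TrivialAt X v (coord (lookup X v) v) → Feasible X
  trivialAt⇒feasible X v t x Kx = t x (λ i _ → Kx i) (Kx v)

  trivialAt⊎nonzero : ∀ X v f → TrivialAt X v f ⊎
    ∃ λ x → x ≢ ⊥ × OffKernel X v x × f x ≡ false
  trivialAt⊎nonzero X v f = map₁ (λ t x Kx fx → t x (Kx , fx)) $ trivial⊎nonzero λ x →
    all? (λ i → ¬? (i ≟ v) →-dec (transversal X i x ≟ᵇ false)) ×-dec (f x ≟ᵇ false)

  -- The functionals p, q and p + q at `v` enter here in several orders: over F₂ each is the sum of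
  -- the other two.
  module _ (X : Subset n) (v : Fin n) (f g h : Functional n)
           (f+g≡h : ∀ x → f x xor g x ≡ h x) where

    -- By dimension, n − 1 conditions leave a nonzero x.
    ¬allTrivialAt : TrivialAt X v f → TrivialAt X v g → ¬ TrivialAt X v h
    ¬allTrivialAt tf tg th = let x , x≢⊥ , Kx = kernelWithout v (transversal X) (λ i → coord-linear (lookup X i) i) in
      [ x≢⊥ ∘ tf x Kx , [ x≢⊥ ∘ tg x Kx , x≢⊥ ∘ th x Kx ]′ ]′ (oneVanishes (f+g≡h x))
      where
      oneVanishes : ∀ {a b c} → a xor b ≡ c → a ≡ false ⊎ b ≡ false ⊎ c ≡ false
      oneVanishes {false}        _ = inj₁ refl
      oneVanishes {true} {false} _ = inj₂ (inj₁ refl)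
      oneVanishes {true} {true}  e = inj₂ (inj₂ (sym e))

    -- A nonzero `y` off `v` with `h y = 0` would have `f y = g y = 1`, while the given `x` has
    -- `f x = 1` and `g x = 0`. The form of `x` and `y` at `v` would be 1, against isotropy.
    trivialAt-third : (∀ x y → (f x ∧ g y) xor (g x ∧ f y) ≡ form v x y) →
      TrivialAt X v f → (∃ λ x → x ≢ ⊥ × OffKernel X v x × g x ≡ false) → TrivialAt X v h
    trivialAt-third fg≡form tf (x , x≢⊥ , Kx , gx) y Ky hy =
      decidable-stable (≡-dec _≟ᵇ_ y ⊥) λ y≢⊥ →
        let fx = ¬-not (x≢⊥ ∘ tf x Kx)
            fy = ¬-not (y≢⊥ ∘ tf y Ky)
        in contradiction
             (trans (sym (hyperbolic fx gx fy (trans (f+g≡h y) hy)))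
               (trans (fg≡form x y) (offKernel-form X v Kx Ky)))
             λ ()
      where
      hyperbolic : ∀ {a b c d} → a ≡ true → b ≡ false → c ≡ true → c xor d ≡ false →
        (a ∧ d) xor (b ∧ c) ≡ true
      hyperbolic {d = true} refl refl refl _ = refl

-- Pivots and loop complementations

open IsotropicSystem using (Feasible; TrivialAt)

TrivialKernel-cong : {F G : Fin m → Functional n} → (∀ i x → F i x ≡ G i x) →
  TrivialKernel F → TrivialKernel G
TrivialKernel-cong F≡G tF x Gx = tF x λ i → trans (F≡G i x) (Gx i)

≐-trans : {P Q R : SetSystem n} → P ≐ Q → Q ≐ R → P ≐ R
≐-trans (P⊆Q , Q⊆P) (Q⊆R , R⊆Q) = Q⊆R ∘ P⊆Q , Q⊆P ∘ R⊆Q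

✶-cong : {M N : SetSystem n} (X : Subset n) → M ≐ N → M ✶ X ≐ N ✶ X
✶-cong X (M⊆N , N⊆M) =
  (λ (Y , Y∈M , eq) → Y , M⊆N Y∈M , eq) , (λ (Y , Y∈N , eq) → Y , N⊆M Y∈N , eq)

△-cancelʳ : (Y X : Subset n) → Y △ X △ X ≡ Y
△-cancelʳ Y X = lookup-injective λ i → begin
  lookup (Y △ X △ X) i                        ≡⟨ lookup-△ (Y △ X) X i ⟩
  lookup (Y △ X) i xor lookup X i             ≡⟨ cong (_xor lookup X i) (lookup-△ Y X i) ⟩
  (lookup Y i xor lookup X i) xor lookup X i  ≡⟨ xor-assoc (lookup Y i) _ _ ⟩
  lookup Y i xor (lookup X i xor lookup X i)  ≡⟨ cong (lookup Y i xor_) (xor-same (lookup X i)) ⟩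
  lookup Y i xor false                        ≡⟨ xor-identityʳ _ ⟩
  lookup Y i                                  ∎
  where open ≡-Reasoning

∈-✶⁻ : {M : SetSystem n} {X Z : Subset n} → Z ∈ M ✶ X → Z △ X ∈ M
∈-✶⁻ {M = M} {X} (Y , Y∈M , refl) = subst M (sym (△-cancelʳ Y X)) Y∈M

∈-✶⁺ : {M : SetSystem n} {X Z : Subset n} → Z △ X ∈ M → Z ∈ M ✶ X
∈-✶⁺ {X = X} {Z} Z△X∈M = Z △ X , Z△X∈M , sym (△-cancelʳ Z X)

✶-involutive : (M : SetSystem n) (X : Subset n) → M ≐ M ✶ X ✶ X
✶-involutive M X =
  (λ {Y} Y∈M → ∈-✶⁺ {M = M ✶ X} (Y , Y∈M , refl)) ,
  (λ {Y} Y∈ → subst M (△-cancelʳ Y X) (∈-✶⁻ (∈-✶⁻ {M = M ✶ X} Y∈)))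

pivotSystem : IsotropicSystem n → Subset n → IsotropicSystem n
pivotSystem S X = record
  { p         = λ i → coord (lookup X i) i
  ; q         = λ i → coord (not (lookup X i)) i
  ; p-linear  = λ i → coord-linear (lookup X i) i
  ; q-linear  = λ i → coord-linear (not (lookup X i)) i
  ; isotropic = λ x y → trans (sum-cong-≗ λ i → sym (form-coord (lookup X i) i x y)) (isotropic x y)
  }
  where open IsotropicSystem S

-- Selecting a coordinate after a swap composes by xor, so the transversal of `Z` in the pivoted
-- system is that of `Z △ X` in `S`.
feasible-pivot : (S : IsotropicSystem n) (X : Subset n) →
  Feasible (pivotSystem S X) ≐ Feasible S ✶ X
feasible-pivot S X =
  (λ {Z} fZ → ∈-✶⁺ {M = Feasible S} (TrivialKernel-cong (transversal-pivot Z) fZ)) ,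
  (λ {Z} Z∈ → TrivialKernel-cong (λ i x → sym (transversal-pivot Z i x)) (∈-✶⁻ {M = Feasible S} Z∈))
  where
  open IsotropicSystem S using (coord; transversal)

  coord-xor : ∀ a b i x →
    (if a then coord (not b) i else coord b i) x ≡ coord (a xor b) i x
  coord-xor false b i x = refl
  coord-xor true  b i x = refl

  transversal-pivot : ∀ Z i x →
    IsotropicSystem.transversal (pivotSystem S X) Z i x ≡ transversal (Z △ X) i x
  transversal-pivot Z i x = trans (coord-xor (lookup Z i) (lookup X i) i x)
    (cong (λ b → coord b i x) (sym (lookup-△ Z X i)))

-- A symplectic transvection at `v`: q becomes p + q and p stays. The two extra products of
-- p-coordinates cancel modulo 2. Writing the case distinction as a factor `does (i ≟ v)` keeps the
-- identities polynomial for the solver.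
loopSystem : IsotropicSystem n → Fin n → IsotropicSystem n
loopSystem S v = record
  { p         = p
  ; q         = λ i x → q i x xor (does (i ≟ v) ∧ p i x)
  ; p-linear  = p-linear
  ; q-linear  = λ i x y → trans
      (cong₂ (λ a b → a xor (does (i ≟ v) ∧ b)) (q-linear i x y) (p-linear i x y))
      (solve 5 (λ d a b c e →
         (a :+ b) :+ d :* (c :+ e) := (a :+ d :* c) :+ (b :+ d :* e)) refl
         (does (i ≟ v)) (q i x) (q i y) (p i x) (p i y))
  ; isotropic = λ x y → trans
      (sum-cong-≗ λ i → solve 5 (λ d a b c e →
         c :* (b :+ d :* e) :+ (a :+ d :* c) :* e := c :* b :+ a :* e) refl
         (does (i ≟ v)) (q i x) (q i y) (p i x) (p i y))
      (isotropic x y)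
  }
  where
  open IsotropicSystem S
  open xor-∧-Solver

∉⇒lookup≡false : {v : Fin n} {Z : Subset n} → v FS.∉ Z → lookup Z v ≡ false
∉⇒lookup≡false {v = v} {Z} v∉Z = ¬-not (v∉Z ∘ lookup⇒[]= v Z)

lookup≡false⇒∉ : {v : Fin n} {Z : Subset n} → lookup Z v ≡ false → v FS.∉ Z
lookup≡false⇒∉ eq v∈Z = contradiction (trans (sym eq) ([]=⇒lookup v∈Z)) λ ()

module _ (M : SetSystem n) (v : Fin n) where

  -- The set system local to the definition of M +ᵛ v, restated.
  Added : SetSystem n
  Added Y = ∃ λ Z → Z ∈ M × v FS.∉ Z × Y ≡ Z FS.∪ ⁅ v ⁆

  lookup-∪⁅⁆ : ∀ (Z : Subset n) i → lookup (Z FS.∪ ⁅ v ⁆) i ≡ lookup Z i ∨ does (i ≟ v)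
  lookup-∪⁅⁆ Z i = trans (lookup-zipWith _∨_ i Z ⁅ v ⁆) (cong (lookup Z i ∨_) (lookup-⁅⁆ v i))

  added⁻ : ∀ {Y} → Y ∈ Added → lookup Y v ≡ true × Y △ ⁅ v ⁆ ∈ M
  added⁻ (Z , Z∈M , v∉Z , refl) =
    trans (lookup-∪⁅⁆ Z v) (trans (cong (lookup Z v ∨_) (dec-true (v ≟ v) refl)) (∨-zeroʳ _)) ,
    subst M (sym (lookup-injective λ i → trans (lookup-△⁅⁆ (Z FS.∪ ⁅ v ⁆) v i)
      (trans (cong (_xor does (i ≟ v)) (lookup-∪⁅⁆ Z i)) (remove i)))) Z∈M
    where
    remove : ∀ i → (lookup Z i ∨ does (i ≟ v)) xor does (i ≟ v) ≡ lookup Z i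
    remove i with i ≟ v
    ... | no _ = trans (xor-identityʳ _) (∨-identityʳ _)
    ... | yes refl rewrite ∉⇒lookup≡false v∉Z = refl

  added⁺ : ∀ {Y} → lookup Y v ≡ true → Y △ ⁅ v ⁆ ∈ M → Y ∈ Added
  added⁺ {Y} v∈Y Z∈M = Y △ ⁅ v ⁆ , Z∈M ,
    lookup≡false⇒∉ (trans (lookup-△⁅⁆-≡ Y v) (cong not v∈Y)) ,
    lookup-injective λ i → sym (trans (lookup-∪⁅⁆ (Y △ ⁅ v ⁆) i)
      (trans (cong (_∨ does (i ≟ v)) (lookup-△⁅⁆ Y v i)) (add i)))
    where
    add : ∀ i → (lookup Y i xor does (i ≟ v)) ∨ does (i ≟ v) ≡ lookup Y i
    add i with i ≟ v
    ... | no _ = trans (∨-identityʳ _) (xor-identityʳ _)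
    ... | yes refl rewrite v∈Y = refl

-- Symmetric difference also uses non-membership, so each inclusion of the conclusion consumes both
-- inclusions of the hypothesis.
+ᵛ-cong : {M N : SetSystem n} (v : Fin n) → M ≐ N → M +ᵛ v ≐ N +ᵛ v
+ᵛ-cong {M = M} {N} v (M⊆N , N⊆M) = mono M⊆N N⊆M , mono N⊆M M⊆N
  where
  mono : {P Q : SetSystem _} → (∀ {X} → P X → Q X) → (∀ {X} → Q X → P X) →
    ∀ {X} → X ∈ P +ᵛ v → X ∈ Q +ᵛ v
  mono P⊆Q Q⊆P (inj₁ (X∈P , ¬added)) =
    inj₁ (P⊆Q X∈P , λ (Z , Z∈Q , rest) → ¬added (Z , Q⊆P Z∈Q , rest))
  mono P⊆Q Q⊆P (inj₂ ((Z , Z∈P , rest) , X∉P)) =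
    inj₂ ((Z , P⊆Q Z∈P , rest) , X∉P ∘ Q⊆P)

module _ (S : IsotropicSystem n) (v : Fin n) where
  open IsotropicSystem S hiding (Feasible; TrivialAt)

  private
    S′ : IsotropicSystem n
    S′ = loopSystem S v

    p+q : Functional n
    p+q x = q v x xor p v x

  transversal-loop-≢ : ∀ X {i} → i ≢ v → ∀ x →
    IsotropicSystem.transversal S′ X i x ≡ transversal X i x
  transversal-loop-≢ X {i} i≢v x with lookup X i
  ... | false = refl
  ... | true  = trans (cong (λ d → q i x xor (d ∧ p i x)) (dec-false (i ≟ v) i≢v)) (xor-identityʳ _)

  q-loop : ∀ x → IsotropicSystem.q S′ v x ≡ p+q x
  q-loop x = cong (λ d → q v x xor (d ∧ p v x)) (dec-true (v ≟ v) refl)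

  loop-∉ : ∀ Y → lookup Y v ≡ false → ∀ i x →
    IsotropicSystem.transversal S′ Y i x ≡ transversal Y i x
  loop-∉ Y v∉Y i x = case i ≟ v of λ where
    (no i≢v)   → transversal-loop-≢ Y i≢v x
    (yes refl) → trans (cong (λ b → IsotropicSystem.coord S′ b v x) v∉Y)
                       (cong (λ b → coord b v x) (sym v∉Y))

  -- For `Y` containing `v`, feasibility of `Y △ ⁅ v ⁆` and of `Y` in `S`, and of `Y` in `S′`,
  -- become triviality of p, q and p + q at `v` under the same conditions elsewhere.
  module _ (Y : Subset n) (v∈Y : lookup Y v ≡ true) where

    TrivialAt-p⁺ : Feasible S (Y △ ⁅ v ⁆) → TrivialAt S Y v (p v)
    TrivialAt-p⁺ f x Kx px = feasible⇒trivialAt (Y △ ⁅ v ⁆) v f x (offKernel-△⁅⁆⁻ Y v Kx)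
      (trans (cong (λ b → coord b v x) (trans (lookup-△⁅⁆-≡ Y v) (cong not v∈Y))) px)

    TrivialAt-p⁻ : TrivialAt S Y v (p v) → Feasible S (Y △ ⁅ v ⁆)
    TrivialAt-p⁻ t = trivialAt⇒feasible (Y △ ⁅ v ⁆) v λ x Kx vx → t x (offKernel-△⁅⁆ Y v Kx)
      (trans (cong (λ b → coord b v x) (sym (trans (lookup-△⁅⁆-≡ Y v) (cong not v∈Y)))) vx)

    TrivialAt-q⁺ : Feasible S Y → TrivialAt S Y v (q v)
    TrivialAt-q⁺ = subst (λ b → TrivialAt S Y v (coord b v)) v∈Y ∘ feasible⇒trivialAt Y v

    TrivialAt-q⁻ : TrivialAt S Y v (q v) → Feasible S Y
    TrivialAt-q⁻ = trivialAt⇒feasible Y v ∘ subst (λ b → TrivialAt S Y v (coord b v)) (sym v∈Y)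

    transversal-loop-v : ∀ x → IsotropicSystem.transversal S′ Y v x ≡ p+q x
    transversal-loop-v x = trans (cong (λ b → IsotropicSystem.coord S′ b v x) v∈Y) (q-loop x)

    TrivialAt-p+q⁺ : Feasible S′ Y → TrivialAt S Y v p+q
    TrivialAt-p+q⁺ f x Kx vx = IsotropicSystem.feasible⇒trivialAt S′ Y v f x
      (λ i i≢v → trans (transversal-loop-≢ Y i≢v x) (Kx i i≢v))
      (trans (transversal-loop-v x) vx)

    TrivialAt-p+q⁻ : TrivialAt S Y v p+q → Feasible S′ Y
    TrivialAt-p+q⁻ t = IsotropicSystem.trivialAt⇒feasible S′ Y v λ x Kx vx → t x
      (λ i i≢v → trans (sym (transversal-loop-≢ Y i≢v x)) (Kx i i≢v))
      (trans (sym (transversal-loop-v x)) vx)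

    p,q⇒¬p+q : TrivialAt S Y v (p v) → TrivialAt S Y v (q v) → ¬ TrivialAt S Y v p+q
    p,q⇒¬p+q = ¬allTrivialAt Y v (p v) (q v) p+q λ x → xor-comm (p v x) (q v x)

    p,¬q⇒p+q : TrivialAt S Y v (p v) → ¬ TrivialAt S Y v (q v) → TrivialAt S Y v p+q
    p,¬q⇒p+q tp ¬tq = [ (λ tq → contradiction tq ¬tq) , trivialAt-third Y v (p v) (q v) p+q
      (λ x → xor-comm (p v x) (q v x)) (λ _ _ → refl) tp ]′ (trivialAt⊎nonzero Y v (q v))

    q,¬p⇒p+q : TrivialAt S Y v (q v) → ¬ TrivialAt S Y v (p v) → TrivialAt S Y v p+q
    q,¬p⇒p+q tq ¬tp = [ (λ tp → contradiction tp ¬tp) , trivialAt-third Y v (q v) (p v) p+q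
      (λ _ → refl) (λ x y → xor-comm (q v x ∧ p v y) _) tq ]′ (trivialAt⊎nonzero Y v (p v))

    -- If p is trivial too, the dimension count excludes q. Otherwise a nonzero vector on the line p
    -- = 0 makes q the second trivial functional.
    p+q⇒p,¬q⊎q,¬p : TrivialAt S Y v p+q →
      (TrivialAt S Y v (p v) × ¬ TrivialAt S Y v (q v)) ⊎
      (TrivialAt S Y v (q v) × ¬ TrivialAt S Y v (p v))
    p+q⇒p,¬q⊎q,¬p tr with trivialAt⊎nonzero Y v (p v)
    ... | inj₁ tp = inj₁ (tp , λ tq → p,q⇒¬p+q tp tq tr)
    ... | inj₂ nonzero@(x , x≢⊥ , Kx , px) = inj₂
      ( trivialAt-third Y v p+q (p v) (q v) p+q+p form-p+q tr nonzero
      , λ tp → x≢⊥ (tp x Kx px))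
      where
      open xor-∧-Solver
      p+q+p : ∀ x → p+q x xor p v x ≡ q v x
      p+q+p x = solve 2 (λ a b → (b :+ a) :+ a := b) refl (p v x) (q v x)

      form-p+q : ∀ x y → (p+q x ∧ p v y) xor (p v x ∧ p+q y) ≡ form v x y
      form-p+q x y = solve 4 (λ a b c d →
        (b :+ a) :* c :+ a :* (d :+ c) := a :* d :+ b :* c) refl (p v x) (q v x) (p v y) (q v y)

  -- A set avoiding `v` selects p there, which the transvection fixes. For `Y` containing `v`,
  -- membership in the loop complementation means that exactly one of `Y` and `Y △ ⁅ v ⁆` is
  -- feasible, which by the rule on three lines means that p + q is trivial.
  feasible-loop : Feasible S′ ≐ Feasible S +ᵛ v
  feasible-loop = (λ {Y} → to Y (lookup Y v) refl) , (λ {Y} → from Y (lookup Y v) refl)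
    where
    to : ∀ Y b → lookup Y v ≡ b → Feasible S′ Y → Y ∈ Feasible S +ᵛ v
    to Y false v∉Y f = inj₁ (TrivialKernel-cong (loop-∉ Y v∉Y) f ,
      λ added → contradiction (trans (sym v∉Y) (proj₁ (added⁻ (Feasible S) v added))) λ ())
    to Y true v∈Y f with p+q⇒p,¬q⊎q,¬p Y v∈Y (TrivialAt-p+q⁺ Y v∈Y f)
    ... | inj₁ (tp , ¬tq) =
      inj₂ (added⁺ (Feasible S) v v∈Y (TrivialAt-p⁻ Y v∈Y tp) , ¬tq ∘ TrivialAt-q⁺ Y v∈Y)
    ... | inj₂ (tq , ¬tp) = inj₁ (TrivialAt-q⁻ Y v∈Y tq ,
      λ added → ¬tp (TrivialAt-p⁺ Y v∈Y (proj₂ (added⁻ (Feasible S) v added))))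

    from : ∀ Y b → lookup Y v ≡ b → Y ∈ Feasible S +ᵛ v → Feasible S′ Y
    from Y false v∉Y (inj₁ (f , _)) = TrivialKernel-cong (λ i x → sym (loop-∉ Y v∉Y i x)) f
    from Y false v∉Y (inj₂ (added , _)) =
      contradiction (trans (sym v∉Y) (proj₁ (added⁻ (Feasible S) v added))) λ ()
    from Y true v∈Y (inj₁ (f , ¬added)) = TrivialAt-p+q⁻ Y v∈Y $
      q,¬p⇒p+q Y v∈Y (TrivialAt-q⁺ Y v∈Y f) (¬added ∘ added⁺ (Feasible S) v v∈Y ∘ TrivialAt-p⁻ Y v∈Y)
    from Y true v∈Y (inj₂ (added , ¬f)) = TrivialAt-p+q⁻ Y v∈Y $
      p,¬q⇒p+q Y v∈Y (TrivialAt-p⁺ Y v∈Y (proj₂ (added⁻ (Feasible S) v added)))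
        (¬f ∘ TrivialAt-q⁻ Y v∈Y)

  -- Feasible sets avoiding `v` survive. A feasible `Y` containing `v` is lost only if `Y △ ⁅ v ⁆`
  -- is feasible, and that set avoids `v`.
  satisfiable-loop : Satisfiable (Feasible S) → Satisfiable (Feasible S′)
  satisfiable-loop (Y , f) with lookup Y v in v∈?Y
  ... | false = Y , TrivialKernel-cong (λ i x → sym (loop-∉ Y v∈?Y i x)) f
  ... | true with trivialAt⊎nonzero Y v (p v)
  ...   | inj₁ tp = Y △ ⁅ v ⁆ , TrivialKernel-cong
    (λ i x → sym (loop-∉ (Y △ ⁅ v ⁆) (trans (lookup-△⁅⁆-≡ Y v) (cong not v∈?Y)) i x)) (TrivialAt-p⁻ Y v∈?Y tp)
  ...   | inj₂ (x , x≢⊥ , Kx , px) = Y , TrivialAt-p+q⁻ Y v∈?Y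
    (q,¬p⇒p+q Y v∈?Y (TrivialAt-q⁺ Y v∈?Y f) λ tp → x≢⊥ (tp x Kx px))

-- Symmetric matrices as isotropic systems

open Representation 𝔽₂

mulVec : Matrix n → Fin n → Functional n
mulVec A i x = sum λ j → A i j ∧ lookup x j

mulVec-linear : ∀ (A : Matrix n) i → Linear (mulVec A i)
mulVec-linear A i x y = trans
  (sum-cong-≗ λ j → trans (cong (A i j ∧_) (lookup-△ x y j)) (∧-distribˡ-xor (A i j) _ _))
  (∑-distrib-+ (λ j → A i j ∧ lookup x j) λ j → A i j ∧ lookup y j)

-- The graph of `A`, parametrised by `x` as the pair of `x` and `A x`. Its isotropy is the
-- self-adjointness of a symmetric matrix.
graphSystem : (A : Matrix n) → SkewSymmetric A → IsotropicSystem n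
graphSystem {n} A skew = record
  { p         = λ i x → lookup x i
  ; q         = mulVec A
  ; p-linear  = λ i x y → lookup-△ x y i
  ; q-linear  = mulVec-linear A
  ; isotropic = isotropic
  }
  where
  open ≡-Reasoning

  form₁ form₂ : Subset n → Subset n → Fin n → Bool
  form₁ x y i = lookup x i ∧ mulVec A i y
  form₂ x y i = mulVec A i x ∧ lookup y i

  adjoint : ∀ x y → sum (form₁ x y) ≡ sum (form₂ x y)
  adjoint x y = begin
    sum (λ i → lookup x i ∧ mulVec A i y)
      ≡⟨ sum-cong-≗ (λ i → *-distribˡ-sum (lookup x i) λ j → A i j ∧ lookup y j) ⟩
    sum (λ i → sum λ j → lookup x i ∧ (A i j ∧ lookup y j))
      ≡⟨ ∑-comm (λ i j → lookup x i ∧ (A i j ∧ lookup y j)) ⟩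
    sum (λ j → sum λ i → lookup x i ∧ (A i j ∧ lookup y j))
      ≡⟨ sum-cong-≗ (λ j → sum-cong-≗ λ i → transpose i j) ⟩
    sum (λ j → sum λ i → (A j i ∧ lookup x i) ∧ lookup y j)
      ≡⟨ sum-cong-≗ (λ j → *-distribʳ-sum (lookup y j) λ i → A j i ∧ lookup x i) ⟨
    sum (λ j → mulVec A j x ∧ lookup y j)
      ∎
    where
    transpose : ∀ i j → lookup x i ∧ (A i j ∧ lookup y j) ≡ (A j i ∧ lookup x i) ∧ lookup y j
    transpose i j = begin
      -- Negation in `𝔽₂` is the identity, so `skew` is plain symmetry.
      lookup x i ∧ (A i j ∧ lookup y j)  ≡⟨ cong (λ a → lookup x i ∧ (a ∧ lookup y j)) (skew j i) ⟩
      lookup x i ∧ (A j i ∧ lookup y j)  ≡⟨ ∧-assoc (lookup x i) _ _ ⟨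
      (lookup x i ∧ A j i) ∧ lookup y j  ≡⟨ cong (_∧ lookup y j) (∧-comm (lookup x i) _) ⟩
      (A j i ∧ lookup x i) ∧ lookup y j  ∎

  isotropic : ∀ x y → sum (λ i → form₁ x y i xor form₂ x y i) ≡ false
  isotropic x y = begin
    sum (λ i → form₁ x y i xor form₂ x y i)  ≡⟨ ∑-distrib-+ (form₁ x y) (form₂ x y) ⟩
    sum (form₁ x y) xor sum (form₂ x y)      ≡⟨ cong (_xor sum (form₂ x y)) (adjoint x y) ⟩
    sum (form₂ x y) xor sum (form₂ x y)      ≡⟨ xor-same (sum (form₂ x y)) ⟩
    false                                    ∎

-- Matrix inverses over F₂

1ᴹ-diagonal : ∀ (i : Fin m) → 1ᴹ i i ≡ true
1ᴹ-diagonal i rewrite dec-true (i ≟ i) refl = refl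

1ᴹ-off : ∀ {i j : Fin m} → i ≢ j → 1ᴹ i j ≡ false
1ᴹ-off {i = i} {j} i≢j rewrite dec-false (i ≟ j) i≢j = refl

sum-1ᴹˡ : ∀ (i : Fin m) (t : Fin m → Bool) → sum (λ j → 1ᴹ i j ∧ t j) ≡ t i
sum-1ᴹˡ i t = trans
  (sum-isolate (λ j → 1ᴹ i j ∧ t j) i λ j j≢i → cong (_∧ t j) (1ᴹ-off (j≢i ∘ sym)))
  (cong (_∧ t i) (1ᴹ-diagonal i))

sum-1ᴹʳ : ∀ (i : Fin m) (t : Fin m → Bool) → sum (λ j → t j ∧ 1ᴹ j i) ≡ t i
sum-1ᴹʳ i t = trans
  (sum-isolate (λ j → t j ∧ 1ᴹ j i) i λ j j≢i → trans (cong (t j ∧_) (1ᴹ-off j≢i)) (∧-zeroʳ (t j)))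
  (trans (cong (t i ∧_) (1ᴹ-diagonal i)) (∧-identityʳ (t i)))

-- Associativity of row times matrix times column, by interchanging the two sums.
sum-assoc : (a : Fin m → Bool) (B : Matrix m) (x : Fin m → Bool) →
  sum (λ k → sum (λ j → a j ∧ B j k) ∧ x k) ≡ sum (λ j → a j ∧ sum (λ k → B j k ∧ x k))
sum-assoc a B x = begin
  sum (λ k → sum (λ j → a j ∧ B j k) ∧ x k)
    ≡⟨ sum-cong-≗ (λ k → *-distribʳ-sum (x k) λ j → a j ∧ B j k) ⟩
  sum (λ k → sum λ j → (a j ∧ B j k) ∧ x k)
    ≡⟨ ∑-comm (λ k j → (a j ∧ B j k) ∧ x k) ⟩
  sum (λ j → sum λ k → (a j ∧ B j k) ∧ x k)
    ≡⟨ sum-cong-≗ (λ j → sum-cong-≗ λ k → ∧-assoc (a j) (B j k) (x k)) ⟩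
  sum (λ j → sum λ k → a j ∧ (B j k ∧ x k))
    ≡⟨ sum-cong-≗ (λ j → *-distribˡ-sum (a j) λ k → B j k ∧ x k) ⟨
  sum (λ j → a j ∧ sum (λ k → B j k ∧ x k))
    ∎
  where open ≡-Reasoning

nonsingular⇒trivialKernel : (B : Matrix m) → Nonsingular B → TrivialKernel (mulVec B)
nonsingular⇒trivialKernel {m} B (C , CB≈1 , _) x Bx = lookup-injective λ i → begin
  lookup x i                                           ≡⟨ sum-1ᴹˡ i (lookup x) ⟨
  sum (λ k → 1ᴹ i k ∧ lookup x k)                      ≡⟨ sum-cong-≗ (λ k → cong (_∧ lookup x k) (CB≈1 i k)) ⟨
  sum (λ k → sum (λ j → C i j ∧ B j k) ∧ lookup x k)   ≡⟨ sum-assoc (C i) B (lookup x) ⟩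
  sum (λ j → C i j ∧ mulVec B j x)                     ≡⟨ sum-cong-≗ (λ j → trans (cong (C i j ∧_) (Bx j)) (∧-zeroʳ (C i j))) ⟩
  sum {m} (λ _ → false)                                ≡⟨ sum-replicate-zero m ⟩
  false                                                ≡⟨ lookup-replicate i false ⟨
  lookup (⊥ {m}) i                                     ∎
  where open ≡-Reasoning

-- Solving for the unit vectors gives a right inverse column by column; symmetry of `B` makes its
-- transpose a left inverse.
trivialKernel⇒nonsingular : (B : Matrix m) → SkewSymmetric B → TrivialKernel (mulVec B) → Nonsingular B
trivialKernel⇒nonsingular {m} B skew trivial = C , CB≈1 , BC≈1
  where
  open ≡-Reasoning

  column : (k : Fin m) → ∃ λ x → ∀ i → mulVec B i x ≡ 1ᴹ i k
  column k = trivialKernel⇒surjective (mulVec B) (mulVec-linear B) trivial λ i → 1ᴹ i k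

  C : Matrix m
  C j k = lookup (proj₁ (column k)) j

  BC≈1 : (B *ᴹ C) ≈ᴹ 1ᴹ
  BC≈1 i k = proj₂ (column k) i

  1ᴹ-sym : ∀ i k → 1ᴹ {m} i k ≡ 1ᴹ k i
  1ᴹ-sym i k with i ≟ k
  ... | yes refl = sym (1ᴹ-diagonal i)
  ... | no i≢k   = sym (1ᴹ-off (i≢k ∘ sym))

  CᵀB≈1 : ∀ i k → sum (λ j → C j i ∧ B j k) ≡ 1ᴹ i k
  CᵀB≈1 i k = begin
    sum (λ j → C j i ∧ B j k)  ≡⟨ sum-cong-≗ (λ j → trans (∧-comm (C j i) _) (cong (_∧ C j i) (skew k j))) ⟩
    sum (λ j → B k j ∧ C j i)  ≡⟨ BC≈1 k i ⟩
    1ᴹ k i                     ≡⟨ 1ᴹ-sym k i ⟩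
    1ᴹ i k                     ∎

  -- The left inverse Cᵀ and the right inverse C coincide.
  C-sym : ∀ i k → C i k ≡ C k i
  C-sym i k = begin
    C i k                                           ≡⟨ sum-1ᴹˡ i (λ j → C j k) ⟨
    sum (λ j → 1ᴹ i j ∧ C j k)                      ≡⟨ sum-cong-≗ (λ j → cong (_∧ C j k) (CᵀB≈1 i j)) ⟨
    sum (λ j → sum (λ l → C l i ∧ B l j) ∧ C j k)   ≡⟨ sum-assoc (λ l → C l i) B (λ j → C j k) ⟩
    sum (λ l → C l i ∧ sum (λ j → B l j ∧ C j k))   ≡⟨ sum-cong-≗ (λ l → cong (C l i ∧_) (BC≈1 l k)) ⟩
    sum (λ l → C l i ∧ 1ᴹ l k)                      ≡⟨ sum-1ᴹʳ k (λ l → C l i) ⟩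
    C k i                                           ∎

  CB≈1 : (C *ᴹ B) ≈ᴹ 1ᴹ
  CB≈1 i k = trans (sum-cong-≗ λ j → cong (_∧ B j k) (C-sym i j)) (CᵀB≈1 i k)

-- Principal submatrices and vectors supported on a subset

lookup-elements : (X : Subset n) (i : Fin ∣ X ∣) → lookup X (elements X i) ≡ true
lookup-elements (true  ∷ X) zero    = refl
lookup-elements (true  ∷ X) (suc i) = lookup-elements X i
lookup-elements (false ∷ X) i       = lookup-elements X i

elements-surjective : (X : Subset n) (v : Fin n) → lookup X v ≡ true → ∃ λ i → elements X i ≡ v
elements-surjective (true ∷ X) zero _ = zero , refl
elements-surjective (true ∷ X) (suc v) v∈X =
  let i , eq = elements-surjective X v v∈X in suc i , cong suc eq
elements-surjective (false ∷ X) (suc v) v∈X =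
  let i , eq = elements-surjective X v v∈X in i , cong suc eq

sum-elements : (X : Subset n) (t : Fin n → Bool) → (∀ v → lookup X v ≡ false → t v ≡ false) →
  sum (t ∘ elements X) ≡ sum t
sum-elements []          t off = refl
sum-elements (true  ∷ X) t off = cong (t zero xor_) (sum-elements X (t ∘ suc) (off ∘ suc))
sum-elements (false ∷ X) t off =
  trans (sum-elements X (t ∘ suc) (off ∘ suc)) (cong (_xor sum (t ∘ suc)) (sym (off zero refl)))

restrict : (X : Subset n) → Subset n → Subset ∣ X ∣
restrict X x = tabulate (lookup x ∘ elements X)

extend : (X : Subset n) → Subset ∣ X ∣ → Subset n
extend []          y       = []
extend (true  ∷ X) (b ∷ y) = b ∷ extend X y
extend (false ∷ X) y       = false ∷ extend X y

lookup-extend-elements : ∀ (X : Subset n) y i → lookup (extend X y) (elements X i) ≡ lookup y i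
lookup-extend-elements (true  ∷ X) (b ∷ y) zero    = refl
lookup-extend-elements (true  ∷ X) (b ∷ y) (suc i) = lookup-extend-elements X y i
lookup-extend-elements (false ∷ X) y       i       = lookup-extend-elements X y i

lookup-extend-∉ : ∀ (X : Subset n) y v → lookup X v ≡ false → lookup (extend X y) v ≡ false
lookup-extend-∉ (true  ∷ X) (b ∷ y) (suc v) v∉X = lookup-extend-∉ X y v v∉X
lookup-extend-∉ (false ∷ X) y       zero    v∉X = refl
lookup-extend-∉ (false ∷ X) y       (suc v) v∉X = lookup-extend-∉ X y v v∉X

restrict-extend : ∀ (X : Subset n) y → restrict X (extend X y) ≡ y
restrict-extend X y = trans (tabulate-cong (lookup-extend-elements X y)) (tabulate∘lookup y)

mulVec-restrict : ∀ (A : Matrix n) X x → (∀ v → lookup X v ≡ false → lookup x v ≡ false) →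
  ∀ i → mulVec (A [ X ]) i (restrict X x) ≡ mulVec A (elements X i) x
mulVec-restrict A X x off i = trans
  (sum-cong-≗ λ j → cong (A (elements X i) (elements X j) ∧_) (lookup∘tabulate _ j))
  (sum-elements X (λ v → A (elements X i) v ∧ lookup x v)
    λ v v∉X → trans (cong (A (elements X i) v ∧_) (off v v∉X)) (∧-zeroʳ _))

module _ (A : Matrix n) (skew : SkewSymmetric A) where
  open IsotropicSystem (graphSystem A skew) using (coord; transversal)

  transversal-∉ : ∀ X v x → lookup X v ≡ false → transversal X v x ≡ lookup x v
  transversal-∉ X v x v∉X = cong (λ b → coord b v x) v∉X

  transversal-∈ : ∀ X i x → transversal X (elements X i) x ≡ mulVec A (elements X i) x
  transversal-∈ X i x = cong (λ b → coord b (elements X i) x) (lookup-elements X i)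

  -- The p-conditions outside `X` say that `x` is supported on `X`; the q-conditions inside `X` then
  -- say that its restriction is annihilated by `A [ X ]`.
  trivialKernel⇒feasible : ∀ X → TrivialKernel (mulVec (A [ X ])) → Feasible (graphSystem A skew) X
  trivialKernel⇒feasible X trivial x Kx = lookup-injective λ v →
    trans (vanishes v (lookup X v) refl) (sym (lookup-replicate v false))
    where
    off : ∀ v → lookup X v ≡ false → lookup x v ≡ false
    off v v∉X = trans (sym (transversal-∉ X v x v∉X)) (Kx v)

    restrict≡⊥ : restrict X x ≡ ⊥
    restrict≡⊥ = trivial (restrict X x) λ i →
      trans (mulVec-restrict A X x off i) (trans (sym (transversal-∈ X i x)) (Kx (elements X i)))

    vanishes : ∀ v b → lookup X v ≡ b → lookup x v ≡ false
    vanishes v false v∉X = off v v∉X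
    vanishes v true  v∈X with elements-surjective X v v∈X
    ... | i , refl = begin
      lookup x (elements X i)  ≡⟨ lookup∘tabulate (lookup x ∘ elements X) i ⟨
      lookup (restrict X x) i  ≡⟨ cong (λ y → lookup y i) restrict≡⊥ ⟩
      lookup ⊥ i               ≡⟨ lookup-replicate i false ⟩
      false                    ∎
      where open ≡-Reasoning

  feasible⇒trivialKernel : ∀ X → Feasible (graphSystem A skew) X → TrivialKernel (mulVec (A [ X ]))
  feasible⇒trivialKernel X fX y Ky = lookup-injective λ i → begin
    lookup y i                        ≡⟨ lookup-extend-elements X y i ⟨
    lookup (extend X y) (elements X i)  ≡⟨ cong (λ x → lookup x (elements X i)) extend≡⊥ ⟩
    lookup ⊥ (elements X i)           ≡⟨ lookup-replicate (elements X i) false ⟩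
    false                             ≡⟨ lookup-replicate i false ⟨
    lookup ⊥ i                        ∎
    where
    open ≡-Reasoning

    vanishes : ∀ v b → lookup X v ≡ b → transversal X v (extend X y) ≡ false
    vanishes v false v∉X = trans (transversal-∉ X v _ v∉X) (lookup-extend-∉ X y v v∉X)
    vanishes v true v∈X with elements-surjective X v v∈X
    ... | i , refl = begin
      transversal X (elements X i) (extend X y)      ≡⟨ transversal-∈ X i _ ⟩
      mulVec A (elements X i) (extend X y)           ≡⟨ mulVec-restrict A X (extend X y) (lookup-extend-∉ X y) i ⟨
      mulVec (A [ X ]) i (restrict X (extend X y))   ≡⟨ cong (mulVec (A [ X ]) i) (restrict-extend X y) ⟩
      mulVec (A [ X ]) i y                           ≡⟨ Ky i ⟩
      false                                          ∎

    extend≡⊥ : extend X y ≡ ⊥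
    extend≡⊥ = fX (extend X y) λ v → vanishes v (lookup X v) refl

  𝓜≐feasible : 𝓜 A ≐ Feasible (graphSystem A skew)
  𝓜≐feasible =
    (λ {X} → trivialKernel⇒feasible X ∘ nonsingular⇒trivialKernel (A [ X ])) ,
    (λ {X} → trivialKernel⇒nonsingular (A [ X ]) (λ i j → skew (elements X i) (elements X j))
           ∘ feasible⇒trivialKernel X)

-- Isotropic systems in which the empty set is feasible, as graphs

module _ (S : IsotropicSystem n) (p-trivial : TrivialKernel (IsotropicSystem.p S)) where
  open IsotropicSystem S hiding (Feasible; TrivialAt)

  private
    basis : (j : Fin n) → ∃ λ c → ∀ i → p i c ≡ 1ᴹ i j
    basis j = trivialKernel⇒surjective p p-linear p-trivial λ i → 1ᴹ i j

    c : Fin n → Subset n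
    c = proj₁ ∘ basis

  -- Column `j` is the q-part of the vector `c j`, whose p-part is the `j`-th unit vector.
  matrix : Matrix n
  matrix i j = q i (c j)

  -- Isotropy of y against the basis vector dual to p i.
  q≡matrix-p : ∀ i y → q i y ≡ sum (λ j → q j (c i) ∧ p j y)
  q≡matrix-p i y = sym (xor≡false⇒≡ _ _ (begin
    sum (λ j → q j (c i) ∧ p j y) xor q i y
      ≡⟨ cong₂ _xor_ (sum-cong-≗ λ j → ∧-comm (q j (c i)) _) (sym (sum-1ᴹʳ i λ j → q j y)) ⟩
    sum (λ j → p j y ∧ q j (c i)) xor sum (λ j → q j y ∧ 1ᴹ j i)
      ≡⟨ cong (sum (λ j → p j y ∧ q j (c i)) xor_) (sum-cong-≗ λ j → cong (q j y ∧_) (proj₂ (basis i) j)) ⟨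
    sum (λ j → p j y ∧ q j (c i)) xor sum (λ j → q j y ∧ p j (c i))
      ≡⟨ ∑-distrib-+ (λ j → p j y ∧ q j (c i)) (λ j → q j y ∧ p j (c i)) ⟨
    sum (λ j → form j y (c i))
      ≡⟨ isotropic y (c i) ⟩
    false
      ∎))
    where open ≡-Reasoning

  matrix-skew : SkewSymmetric matrix
  matrix-skew i j = begin
    q j (c i)                              ≡⟨ q≡matrix-p j (c i) ⟩
    sum (λ k → q k (c j) ∧ p k (c i))      ≡⟨ sum-cong-≗ (λ k → cong (q k (c j) ∧_) (proj₂ (basis i) k)) ⟩
    sum (λ k → q k (c j) ∧ 1ᴹ k i)         ≡⟨ sum-1ᴹʳ i (λ k → q k (c j)) ⟩
    q i (c j)                              ∎
    where open ≡-Reasoning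

  private
    G : IsotropicSystem n
    G = graphSystem matrix matrix-skew

  transversal-graph : ∀ X {x y} → (∀ i → lookup x i ≡ p i y) →
    ∀ i → IsotropicSystem.transversal G X i x ≡ transversal X i y
  transversal-graph X {x} {y} x≡py i with lookup X i
  ... | false = x≡py i
  ... | true  = trans
    -- The expansion of `q i y` produces the transposed matrix, hence the use of symmetry.
    (sum-cong-≗ λ j → cong₂ _∧_ (matrix-skew j i) (x≡py j))
    (sym (q≡matrix-p i y))

  -- Taking p-parts is a bijection between the two parameter spaces that respects transversals:
  -- surjectivity gives one inclusion, injectivity the other.
  feasible≐graph : Feasible S ≐ Feasible G
  feasible≐graph =
    (λ {X} f x Kx →
      let y , py≡x = trivialKernel⇒surjective p p-linear p-trivial (lookup x)
          y≡⊥ = f y λ i → trans (sym (transversal-graph X (sym ∘ py≡x) i)) (Kx i)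
      in lookup-injective λ i → begin
        lookup x i  ≡⟨ py≡x i ⟨
        p i y       ≡⟨ cong (p i) y≡⊥ ⟩
        p i ⊥       ≡⟨ linear-⊥ (p i) (p-linear i) ⟩
        false       ≡⟨ lookup-replicate i false ⟨
        lookup ⊥ i  ∎) ,
    (λ {X} f y Ky →
      let x = tabulate λ i → p i y
          x≡py = lookup∘tabulate λ i → p i y
          x≡⊥ = f x λ i → trans (transversal-graph X x≡py i) (Ky i)
      in p-trivial y λ i → begin
        p i y       ≡⟨ x≡py i ⟨
        lookup x i  ≡⟨ cong (λ z → lookup z i) x≡⊥ ⟩
        lookup ⊥ i  ≡⟨ lookup-replicate i false ⟩
        false       ∎)
    where open ≡-Reasoning

-- Properness is carried separately because an isotropic system on a nonempty ground set may have no
-- feasible set, for instance when p and q are all zero.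
HasIsotropicSystem : SetSystem n → Set
HasIsotropicSystem {n} M = Satisfiable M × ∃ λ (S : IsotropicSystem n) → M ≐ Feasible S

≐-sym : {P Q : SetSystem n} → P ≐ Q → Q ≐ P
≐-sym (P⊆Q , Q⊆P) = Q⊆P , P⊆Q

binary⇒isotropic : {M : SetSystem n} → IsBinaryDeltaMatroid M → HasIsotropicSystem M
binary⇒isotropic {M = M} ((sat , _) , A , skew , X , M≐) =
  sat , pivotSystem S X ,
  ≐-trans {Q = 𝓜 A ✶ X} M≐ (≐-trans {Q = Feasible S ✶ X}
    (✶-cong X (𝓜≐feasible A skew)) (≐-sym (feasible-pivot S X)))
  where S = graphSystem A skew

-- Pivoting on some feasible `X` makes the empty set feasible, so a symmetric matrix can be read
-- off; pivoting on `X` again returns to `M`.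
isotropic⇒binary : {M : SetSystem n} → HasIsotropicSystem M → IsBinaryDeltaMatroid M
isotropic⇒binary {M = M} ((X , X∈M) , S , M⊆S , S⊆M) = ((X , X∈M) , exchange) ,
  matrix T p-trivial , matrix-skew T p-trivial , X ,
  ≐-trans {Q = Feasible S} (M⊆S , S⊆M) (≐-trans {Q = Feasible S ✶ X ✶ X} (✶-involutive (Feasible S) X)
    (✶-cong X (≐-trans {Q = Feasible T} (≐-sym (feasible-pivot S X))
      (≐-trans {Q = Feasible G} (feasible≐graph T p-trivial)
        (≐-sym (𝓜≐feasible _ (matrix-skew T p-trivial)))))))
  where
  T = pivotSystem S X

  p-trivial : TrivialKernel (IsotropicSystem.p T)
  -- The p-coordinates of `T` are by definition the transversal of `X` in `S`.
  p-trivial = M⊆S X∈M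

  G = graphSystem (matrix T p-trivial) (matrix-skew T p-trivial)

  exchange : SymmetricExchange M
  exchange Y∈M Z∈M u∈ with IsotropicSystem.symmetricExchange S (M⊆S Y∈M) (M⊆S Z∈M) u∈
  ... | inj₁ f = inj₁ (S⊆M f)
  ... | inj₂ (w , w∈ , w≢u , f) = inj₂ (w , w∈ , w≢u , S⊆M f)

-- Closure under vertex flips

isotropic-generator : (v : Fin n) (M : SetSystem n) (γ : Generator) →
  HasIsotropicSystem M → HasIsotropicSystem (applyGenerator v M γ)
isotropic-generator v M pivot ((X , X∈M) , S , M≐S) =
  (X △ ⁅ v ⁆ , X , X∈M , refl) , pivotSystem S ⁅ v ⁆ ,
  ≐-trans {Q = Feasible S ✶ᵛ v} (✶-cong ⁅ v ⁆ M≐S) (≐-sym (feasible-pivot S ⁅ v ⁆))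
isotropic-generator v M loopc ((X , X∈M) , S , M≐S) =
  (Y , proj₂ M+v≐S′ fY) , loopSystem S v , M+v≐S′
  where
  M+v≐S′ = ≐-trans {Q = Feasible S +ᵛ v} (+ᵛ-cong v M≐S) (≐-sym (feasible-loop S v))
  Yf = satisfiable-loop S v (X , proj₁ M≐S X∈M)
  Y = proj₁ Yf
  fY = proj₂ Yf

isotropic-flip : (v : Fin n) (ρ : VertexFlip) (M : SetSystem n) →
  HasIsotropicSystem M → HasIsotropicSystem (flip M (v , ρ))
isotropic-flip v []      M iso = iso
isotropic-flip v (γ ∷ ρ) M iso =
  isotropic-flip v ρ (applyGenerator v M γ) (isotropic-generator v M γ iso)

binary-vfClosed : VfClosed IsBinaryDeltaMatroid
binary-vfClosed M binary v ρ = isotropic⇒binary (isotropic-flip v ρ M (binary⇒isotropic binary))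

binary-vfSafe : (M : SetSystem n) → IsBinaryDeltaMatroid M → VfSafe M
binary-vfSafe M binary []            = proj₁ binary
binary-vfSafe M binary ((v , ρ) ∷ φ) = binary-vfSafe (flip M (v , ρ)) (binary-vfClosed M binary v ρ) φ

theorem8p2 : VfClosed IsBinaryDeltaMatroid
    × (∀ {n} (M : SetSystem n) → IsBinaryDeltaMatroid M → VfSafe M)
theorem8p2 = binary-vfClosed , binary-vfSafe
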